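{- For any graphs $G$ and $H$, $\nu_I(G\times H)\ge 2\,\nu_I(G)\,\nu_I(H)$. This bound is sharp, that is, there exist graphs $G$ and $H$ for which equality holds.
   Context: All graphs are finite and simple. A matching $M$ of a graph $G$ is an induced matching if no two distinct edges of $M$ are joined by an edge of $G$; $\nu_I(G)$ denotes the maximum cardinality of an induced matching in $G$. The direct product $G\times H$ has vertex set $V(G)\times V(H)$, and $(g,h)$, $(g',h')$ are adjacent if $gg'\in E(G)$ and $hh'\in E(H)$. -}

module Defs where

open import Data.Fin using (Fin; _<_; _<?_)
open import Data.Fin.Properties using (*↔×; inj⇒≟; <-cmp)
open import Data.List using (List; []; _∷_; _++_; map; filter; length; cartesianProduct; allFin)
open import Data.List.Extrema.Nat using (max; xs≤max; argmax-sel)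
open import Data.List.Membership.Propositional using (_∈_)
open import Data.List.Membership.Propositional.Properties
  using (∈-map⁺; ∈-map⁻; ∈-filter⁺; ∈-filter⁻; ∈-++⁺ˡ; ∈-++⁺ʳ; ∈-cartesianProduct⁺; ∈-allFin)
import Data.List.Relation.Binary.Disjoint.DecPropositional as DecDisjoint
open import Data.List.Relation.Binary.Disjoint.Propositional using (Disjoint)
import Data.List.Relation.Binary.Sublist.DecPropositional as DecSublist
open import Data.List.Relation.Binary.Sublist.Propositional using (_⊆_; []; _∷_; _∷ʳ_; minimum)
import Data.List.Relation.Unary.All as All
open import Data.List.Relation.Unary.AllPairs using (AllPairs; []; allPairs?)
open import Data.List.Relation.Unary.Any using (Any; any?; here)
open import Data.List.Relation.Unary.Unique.Propositional using (Unique)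
import Data.List.Relation.Unary.Unique.Propositional.Properties as Unique
open import Data.Nat using (ℕ; _*_; _≤_)
open import Data.Product using (_×_; _,_; proj₁; proj₂; ∃-syntax)
open import Data.Product.Function.NonDependent.Propositional using (_×-↔_)
open import Data.Product.Properties using (≡-dec)
open import Data.Sum using (_⊎_; inj₁; inj₂)
open import Function using (id; Injection; Inverse; _↔_)
open import Function.Construct.Composition using (_↔-∘_)
open import Function.Construct.Symmetry using (↔-sym)
open import Function.Properties.Inverse using (↔⇒↣)
open import Relation.Binary using (Decidable; DecidableEquality; Irreflexive; Symmetric; tri<; tri≈; tri>)
open import Relation.Binary.PropositionalEquality using (_≡_; refl; sym; cong; subst)
open import Relation.Nullary using (¬_; Dec; ¬?; contradiction)
open import Relation.Nullary.Decidable using (_×-dec_)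

-- Finiteness is witnessed by a numbering of the vertices.

record Graph : Set₁ where
  field
    V      : Set
    order  : ℕ
    index  : V ↔ Fin order
    Adj    : V → V → Set
    adj?   : Decidable Adj
    symm   : Symmetric Adj
    irrefl : Irreflexive _≡_ Adj

  number : V → Fin order
  number = Inverse.to index

  vertices : List V
  vertices = map (Inverse.from index) (allFin order)

  -- An edge {u , v} is represented once, by the pair (u , v) with
  -- number u < number v.

  IsEdge : V × V → Set
  IsEdge (u , v) = number u < number v × Adj u v

  isEdge? : ∀ e → Dec (IsEdge e)
  isEdge? (u , v) = (number u <? number v) ×-dec adj? u v

  edges : List (V × V)
  edges = filter isEdge? (cartesianProduct vertices vertices)

  ends : V × V → List V
  ends (u , v) = u ∷ v ∷ []

  NoCommonEnd : V × V → V × V → Set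
  NoCommonEnd e f = Disjoint (ends e) (ends f)

  Joined : V × V → V × V → Set
  Joined e f = Any (λ x → Any (Adj x) (ends f)) (ends e)

  -- Since `edges` has no repetitions, its sublists represent exactly the
  -- sets of edges, with length as cardinality, and AllPairs ranges over
  -- the pairs of distinct edges.

  IsMatching : List (V × V) → Set
  IsMatching M = M ⊆ edges × AllPairs NoCommonEnd M

  IsInducedMatching : List (V × V) → Set
  IsInducedMatching M = IsMatching M × AllPairs (λ e f → ¬ Joined e f) M

  _≟ᵛ_ : DecidableEquality V
  _≟ᵛ_ = inj⇒≟ (↔⇒↣ index)

  isInducedMatching? : ∀ M → Dec (IsInducedMatching M)
  isInducedMatching? M =
    ((M ⊆? edges) ×-dec allPairs? (λ e f → disjoint? (ends e) (ends f)) M)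
    ×-dec allPairs? (λ e f → ¬? (any? (λ x → any? (adj? x) (ends f)) (ends e))) M
    where
    open DecSublist (≡-dec _≟ᵛ_ _≟ᵛ_) using (_⊆?_)
    open DecDisjoint _≟ᵛ_ using (disjoint?)

  ∈-vertices : ∀ v → v ∈ vertices
  ∈-vertices v = subst (_∈ vertices) (Inverse.strictlyInverseʳ index v)
    (∈-map⁺ (Inverse.from index) (∈-allFin (number v)))

  edges-unique : Unique edges
  edges-unique = Unique.filter⁺ isEdge? (Unique.cartesianProduct⁺ vs vs)
    where
    vs : Unique vertices
    vs = Unique.map⁺ (Injection.injective (↔⇒↣ (↔-sym index))) (Unique.allFin⁺ order)

  ∈-edges⁺ : ∀ {u v} → Adj u v → (u , v) ∈ edges ⊎ (v , u) ∈ edges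
  ∈-edges⁺ {u} {v} a with <-cmp (number u) (number v)
  ... | tri< u<v _ _ = inj₁ (∈-filter⁺ isEdge? (∈-cartesianProduct⁺ (∈-vertices u) (∈-vertices v)) (u<v , a))
  ... | tri≈ _ u≡v _ = contradiction a (irrefl (Injection.injective (↔⇒↣ index) u≡v))
  ... | tri> _ _ v<u = inj₂ (∈-filter⁺ isEdge? (∈-cartesianProduct⁺ (∈-vertices v) (∈-vertices u)) (v<u , symm a))

  ∈-edges⁻ : ∀ {e} → e ∈ edges → IsEdge e
  ∈-edges⁻ e∈ = proj₂ (∈-filter⁻ isEdge? {xs = cartesianProduct vertices vertices} e∈)

infixl 7 _×ᵍ_

_×ᵍ_ : Graph → Graph → Graph
G ×ᵍ H = record
  { V      = G.V × H.V
  ; order  = G.order * H.order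
  ; index  = (G.index ×-↔ H.index) ⟫ ↔-sym *↔×
  ; Adj    = λ (g , h) (g′ , h′) → G.Adj g g′ × H.Adj h h′
  ; adj?   = λ (g , h) (g′ , h′) → G.adj? g g′ ×-dec H.adj? h h′
  ; symm   = λ (a , b) → G.symm a , H.symm b
  ; irrefl = λ p (a , _) → G.irrefl (cong proj₁ p) a
  }
  where
  module G = Graph G
  module H = Graph H
  _⟫_ : ∀ {A B C : Set} → A ↔ B → B ↔ C → A ↔ C
  f ⟫ g = g ↔-∘ f

sublists : ∀ {A : Set} → List A → List (List A)
sublists []       = [] ∷ []
sublists (x ∷ xs) = map (x ∷_) (sublists xs) ++ sublists xs

inducedMatchings : (G : Graph) → List (List (Graph.V G × Graph.V G))
inducedMatchings G = filter isInducedMatching? (sublists edges)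
  where open Graph G

ν-I : Graph → ℕ
ν-I G = max 0 (map length (inducedMatchings G))

∈-sublists⁺ : ∀ {A : Set} {xs ys : List A} → xs ⊆ ys → xs ∈ sublists ys
∈-sublists⁺ []                  = here refl
∈-sublists⁺ (y ∷ʳ p)            = ∈-++⁺ʳ _ (∈-sublists⁺ p)
∈-sublists⁺ {xs = x ∷ _} (refl ∷ p) = ∈-++⁺ˡ (∈-map⁺ (x ∷_) (∈-sublists⁺ p))

-- The next two facts say that ν-I G is the maximum of the cardinalities
-- of the induced matchings of G.

ν-I-attained : (G : Graph) → ∃[ M ] Graph.IsInducedMatching G M × length M ≡ ν-I G
ν-I-attained G with argmax-sel id 0 (map length (inducedMatchings G))
... | inj₁ ν≡0 = [] , ((minimum _ , []) , []) , sym ν≡0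
... | inj₂ ν∈ =
  let M , M∈ , ν≡ = ∈-map⁻ length ν∈
  in  M , proj₂ (∈-filter⁻ (Graph.isInducedMatching? G) {xs = sublists (Graph.edges G)} M∈) , sym ν≡

ν-I-upper : (G : Graph) → ∀ M → Graph.IsInducedMatching G M → length M ≤ ν-I G
ν-I-upper G M m@((M⊆E , _) , _) = All.lookup (xs≤max 0 (map length (inducedMatchings G)))
  (∈-map⁺ length (∈-filter⁺ (Graph.isInducedMatching? G) (∈-sublists⁺ M⊆E) m))

{-# OPTIONS --safe #-}

-- Let M and N be induced matchings of G and H. Each edge uv of M and each edge
-- xy of N span two edges (u,x)(v,y) and (u,y)(v,x) of G × H; orienting uv by the
-- vertex numbering, these are the pairs of uv with the two orientations of xy.
-- A contact between two such product edges projects to contacts in G and in H,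
-- so both edges come from the same uv and xy, and the two edges over the same
-- uv and xy do not touch because G and H are irreflexive.
-- Equality holds for K₂ × K₂ = 2 K₂.
module Submission where

open import Defs
open import Data.Fin using (Fin; _≟_)
open import Data.Fin.Properties using (combine-monoˡ-<; <-asym)
open import Data.List using (List; []; _∷_; _++_; map; filter; length; cartesianProductWith)
open import Data.List.Membership.Propositional using (_∈_; find; lose)
open import Data.List.Membership.Propositional.Properties
  using (∈-map⁺; ∈-map⁻; ∈-filter⁺; ∈-filter⁻; ∈-++⁻; ∈-cartesianProductWith⁻)
open import Data.List.Membership.Propositional.Properties.WithK using (unique∧set⇒bag)
import Data.List.Membership.DecPropositional as DecMembership
open import Data.List.Properties using (length-++; length-map)
open import Data.List.Relation.Binary.BagAndSetEquality using (∼bag⇒↭)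
open import Data.List.Relation.Binary.Disjoint.Propositional using (Disjoint)
open import Data.List.Relation.Binary.Permutation.Propositional.Properties using (↭-length)
open import Data.List.Relation.Binary.Sublist.Propositional using (lookup)
open import Data.List.Relation.Binary.Sublist.Propositional.Properties using (filter-⊆)
import Data.List.Relation.Unary.All as All
open import Data.List.Relation.Unary.AllPairs as AllPairs using (AllPairs; []; _∷_)
open import Data.List.Relation.Unary.Any using (here; there)
open import Data.List.Relation.Unary.Unique.Propositional using (Unique)
import Data.List.Relation.Unary.Unique.Propositional.Properties as Unique
open import Data.Nat using (_+_; _*_; _≤_; _≥_)
open import Data.Nat.Properties using (module ≤-Reasoning)
open import Data.Nat.Tactic.RingSolver using (solve-∀)
open import Data.Product using (_×_; _,_; proj₁; proj₂; ∃₂; ∃-syntax; swap)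
open import Data.Product.Properties using (≡-dec)
open import Data.Sum using (_⊎_; inj₁; inj₂)
import Data.Sum as Sum
open import Function using (mk⇔)
open import Function.Construct.Identity using (↔-id)
open import Level using (0ℓ)
open import Relation.Binary using (Rel)
open import Relation.Binary.PropositionalEquality
  using (_≡_; _≢_; refl; sym; trans; cong; cong₂; ≢-sym)
open import Relation.Nullary using (¬_; ¬?; contradiction)

module _ {A : Set} where

  -- `AllPairs` relates only an earlier entry to a later one, and `R` need not be symmetric, so the
  -- order of the two positions decides the case.
  allPairs-lookup : ∀ {R : Rel A 0ℓ} {xs x y} → AllPairs R xs →
                    x ∈ xs → y ∈ xs → x ≡ y ⊎ R x y ⊎ R y x
  allPairs-lookup (r ∷ rs) (here refl) (here refl) = inj₁ refl
  allPairs-lookup (r ∷ rs) (here refl) (there y∈)  = inj₂ (inj₁ (All.lookup r y∈))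
  allPairs-lookup (r ∷ rs) (there x∈)  (here refl) = inj₂ (inj₂ (All.lookup r x∈))
  allPairs-lookup (r ∷ rs) (there x∈)  (there y∈)  = allPairs-lookup rs x∈ y∈

  unique⇒allPairs : ∀ {R : Rel A 0ℓ} {xs} → Unique xs →
                    (∀ {x y} → x ∈ xs → y ∈ xs → x ≢ y → R x y) → AllPairs R xs
  unique⇒allPairs []         r = []
  unique⇒allPairs (x∉ ∷ xs!) r =
    All.tabulate (λ y∈ → r (here refl) (there y∈) (All.lookup x∉ y∈))
    ∷ unique⇒allPairs xs! (λ x∈ y∈ → r (there x∈) (there y∈))

length-cartesianProductWith : ∀ {A B C : Set} (f : A → B → C) xs ys →
  length (cartesianProductWith f xs ys) ≡ length xs * length ys
length-cartesianProductWith f []       ys = refl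
length-cartesianProductWith f (x ∷ xs) ys = trans (length-++ (map (f x) ys))
  (cong₂ _+_ (length-map (f x) ys) (length-cartesianProductWith f xs ys))

module _ (G : Graph) where
  open Graph G

  -- Merges the two prohibitions on an induced matching, a common end and a joining edge, into one
  -- relation that passes from a product to both factors.
  Touch : V → V → Set
  Touch a b = a ≡ b ⊎ Adj a b

  -- An order-free form of the pairwise conditions. Concluding `e ≡ f` lets a contact identify edges
  -- by matching on `refl`.
  Separated : List (V × V) → Set
  Separated M = ∀ {e f a b} → e ∈ M → f ∈ M → a ∈ ends e → b ∈ ends f → Touch a b → e ≡ f

  touch-sym : ∀ {a b} → Touch a b → Touch b a
  touch-sym = Sum.map sym symm

  ends-swap : ∀ {a} e → a ∈ ends (swap e) → a ∈ ends e
  ends-swap e (here p)         = there (here p)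
  ends-swap e (there (here p)) = here p

  apart : ∀ {e f a b} → NoCommonEnd e f × ¬ Joined e f →
          a ∈ ends e → b ∈ ends f → ¬ Touch a b
  apart (d , _) a∈ b∈ (inj₁ refl) = d (a∈ , b∈)
  apart (_ , j) a∈ b∈ (inj₂ ab)   = j (lose a∈ (lose b∈ ab))

  inducedMatching⇒separated : ∀ {M} → IsInducedMatching M → Separated M
  inducedMatching⇒separated ((_ , disjoint) , unjoined) e∈ f∈ a∈ b∈ t
    with allPairs-lookup (AllPairs.zip (disjoint , unjoined)) e∈ f∈
  ... | inj₁ e≡f       = e≡f
  ... | inj₂ (inj₁ ef) = contradiction t (apart ef a∈ b∈)
  ... | inj₂ (inj₂ fe) = contradiction (touch-sym t) (apart fe b∈ a∈)

  -- A repeated edge would share its first end with itself.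
  inducedMatching⇒unique : ∀ {M} → IsInducedMatching M → Unique M
  inducedMatching⇒unique ((_ , disjoint) , _) =
    AllPairs.map (λ { d refl → d (here refl , here refl) }) disjoint

  inducedMatching⇒edge : ∀ {M} → IsInducedMatching M → ∀ {e} → e ∈ M → IsEdge e
  inducedMatching⇒edge ((M⊆E , _) , _) e∈ = ∈-edges⁻ (lookup M⊆E e∈)

  -- `L` may list its edges in any order, while a matching must be a sublist of `edges`.
  -- Repetition-free lists with the same members are permutations of each other, so sorting `L`
  -- preserves its length.
  separated⇒≤ν-I : ∀ {L} → Unique L → (∀ {e} → e ∈ L → IsEdge e) → Separated L →
                   length L ≤ ν-I G
  separated⇒≤ν-I {L} L! edge sep = begin
    length L  ≡⟨ ↭-length (∼bag⇒↭ (unique∧set⇒bag L! M! (mk⇔ L⊆M M⊆L))) ⟩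
    length M  ≤⟨ ν-I-upper G M ((filter-⊆ (_∈? L) edges , disjoint) , unjoined) ⟩
    ν-I G     ∎
    where
    open ≤-Reasoning
    open DecMembership (≡-dec _≟ᵛ_ _≟ᵛ_) using (_∈?_)

    -- L in the order prescribed by `edges`.
    M : List (V × V)
    M = filter (_∈? L) edges

    M! : Unique M
    M! = Unique.filter⁺ (_∈? L) edges-unique

    M⊆L : ∀ {e} → e ∈ M → e ∈ L
    M⊆L e∈ = proj₂ (∈-filter⁻ (_∈? L) {xs = edges} e∈)

    L⊆M : ∀ {e} → e ∈ L → e ∈ M
    L⊆M e∈ with edge e∈
    ... | u<v , uv with ∈-edges⁺ uv
    ...   | inj₁ uv∈ = ∈-filter⁺ (_∈? L) uv∈ e∈
    -- `edges` holds each edge with increasing numbers only, so the reversed pair cannot occur.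
    ...   | inj₂ vu∈ = contradiction (proj₁ (∈-edges⁻ vu∈)) (<-asym u<v)

    disjoint : AllPairs NoCommonEnd M
    disjoint = unique⇒allPairs M! λ e∈ f∈ e≢f (a∈ , b∈) →
      e≢f (sep (M⊆L e∈) (M⊆L f∈) a∈ b∈ (inj₁ refl))

    unjoined : AllPairs (λ e f → ¬ Joined e f) M
    unjoined = unique⇒allPairs M! λ e∈ f∈ e≢f joined →
      let _ , a∈ , p = find joined
          _ , b∈ , ab = find p
      in  e≢f (sep (M⊆L e∈) (M⊆L f∈) a∈ b∈ (inj₂ ab))

module _ {A : Set} where

  -- Meant for one factor only: reversing the edges of both factors would merely exchange the ends
  -- of the product edge.
  orientations : List (A × A) → List (A × A)
  orientations N = N ++ map swap N

  orientations⁻ : ∀ N {f : A × A} → f ∈ orientations N → ∃[ e ] e ∈ N × (f ≡ e ⊎ f ≡ swap e)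
  orientations⁻ N f∈ with ∈-++⁻ N f∈
  ... | inj₁ f∈N = _ , f∈N , inj₁ refl
  ... | inj₂ f∈s = let e , e∈ , f≡ = ∈-map⁻ swap f∈s in e , e∈ , inj₂ f≡

  length-orientations : ∀ N → length (orientations N) ≡ length N + length N
  length-orientations N = trans (length-++ N) (cong (length N +_) (length-map swap N))

module _ (G H : Graph) where
  private
    module G = Graph G
    module H = Graph H
    module P = Graph (G ×ᵍ H)

  over : G.V × G.V → H.V × H.V → P.V × P.V
  over (u , v) (x , y) = (u , x) , (v , y)

  touch⁻ : ∀ {a b} → Touch (G ×ᵍ H) a b → Touch G (proj₁ a) (proj₁ b) × Touch H (proj₂ a) (proj₂ b)
  touch⁻ (inj₁ refl)    = inj₁ refl , inj₁ refl
  touch⁻ (inj₂ (g , h)) = inj₂ g , inj₂ h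

  -- In each of the four cases `a` and `b` agree in exactly one coordinate. The agreement excludes
  -- adjacency, the other coordinate excludes equality.
  crossing-apart : ∀ {u v x y a b} → G.Adj u v → H.Adj x y →
    a ∈ P.ends (over (u , v) (x , y)) → b ∈ P.ends (over (u , v) (y , x)) →
    ¬ Touch (G ×ᵍ H) a b
  crossing-apart uv xy (here refl)         (here refl)         (inj₁ p)       = H.irrefl (cong proj₂ p) xy
  crossing-apart uv xy (here refl)         (here refl)         (inj₂ (p , _)) = G.irrefl refl p
  crossing-apart uv xy (here refl)         (there (here refl)) (inj₁ p)       = G.irrefl (cong proj₁ p) uv
  crossing-apart uv xy (here refl)         (there (here refl)) (inj₂ (_ , p)) = H.irrefl refl p
  crossing-apart uv xy (there (here refl)) (here refl)         (inj₁ p)       = G.irrefl (sym (cong proj₁ p)) uv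
  crossing-apart uv xy (there (here refl)) (here refl)         (inj₂ (_ , p)) = H.irrefl refl p
  crossing-apart uv xy (there (here refl)) (there (here refl)) (inj₁ p)       = H.irrefl (sym (cong proj₂ p)) xy
  crossing-apart uv xy (there (here refl)) (there (here refl)) (inj₂ (p , _)) = G.irrefl refl p

  module _ {M N} (m : G.IsInducedMatching M) (n : H.IsInducedMatching N) where

    matching× : List (P.V × P.V)
    matching× = cartesianProductWith over M (orientations N)

    edgeᴳ : ∀ {e} → e ∈ M → G.IsEdge e
    edgeᴳ = inducedMatching⇒edge G m

    edgeᴴ : ∀ {e} → e ∈ N → H.IsEdge e
    edgeᴴ = inducedMatching⇒edge H n

    matching×-edge : ∀ {e} → e ∈ matching× → P.IsEdge e
    matching×-edge p with ∈-cartesianProductWith⁻ over M (orientations N) p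
    ... | (u , v) , (x , y) , e∈ , f∈ , refl with edgeᴳ e∈ | orientations⁻ N f∈
    -- The product numbering is lexicographic with the `G` coordinate first, so `u<v` settles the
    -- order for both orientations of the `H` edge.
    ...   | u<v , uv | _ , f₀∈ , inj₁ refl =
            combine-monoˡ-< (H.number x) (H.number y) u<v , uv , proj₂ (edgeᴴ f₀∈)
    ...   | u<v , uv | _ , f₀∈ , inj₂ refl =
            combine-monoˡ-< (H.number x) (H.number y) u<v , uv , H.symm (proj₂ (edgeᴴ f₀∈))

    matching×-unique : Unique matching×
    matching×-unique = Unique.cartesianProductWith⁺ over (λ { refl → refl , refl })
      (inducedMatching⇒unique G m) (Unique.++⁺ N! (Unique.map⁺ (λ { refl → refl }) N!) disjoint)
      where
      N! : Unique N
      N! = inducedMatching⇒unique H n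

      -- Edges in `N` have increasing numbers, and their reversals decreasing ones.
      disjoint : Disjoint N (map swap N)
      disjoint (f∈ , f∈s) with ∈-map⁻ swap f∈s
      ... | _ , e∈ , refl = <-asym (proj₁ (edgeᴴ f∈)) (proj₁ (edgeᴴ e∈))

    matching×-separated : Separated (G ×ᵍ H) matching×
    matching×-separated p q a∈ b∈ t
      with ∈-cartesianProductWith⁻ over M (orientations N) p
         | ∈-cartesianProductWith⁻ over M (orientations N) q
    ... | e , f , e∈ , f∈ , refl | e′ , f′ , e′∈ , f′∈ , refl
      -- Projecting the ends of `over e f` by `proj₁` computes to the ends of `e`, and by `proj₂` to
      -- those of `f`.
      with inducedMatching⇒separated G m e∈ e′∈ (∈-map⁺ proj₁ a∈) (∈-map⁺ proj₁ b∈) (proj₁ (touch⁻ t))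
         | orientations⁻ N f∈ | orientations⁻ N f′∈
    ... | refl | g , g∈ , r | g′ , g′∈ , r′
      -- Separation in `H` speaks of members of `N`, so `f` and `f′` are first replaced by `g` and
      -- `g′`, which have the same ends.
      with inducedMatching⇒separated H n g∈ g′∈ (unoriented r (∈-map⁺ proj₂ a∈)) (unoriented r′ (∈-map⁺ proj₂ b∈)) (proj₂ (touch⁻ t))
      where
      unoriented : ∀ {e f a} → f ≡ e ⊎ f ≡ swap e → a ∈ H.ends f → a ∈ H.ends e
      unoriented (inj₁ refl) a∈ = a∈
      unoriented (inj₂ refl) a∈ = ends-swap H _ a∈
    matching×-separated p q a∈ b∈ t
        | e , f , e∈ , f∈ , refl | e′ , f′ , e′∈ , f′∈ , refl
        | refl | g , g∈ , r | g′ , g′∈ , r′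
        | refl with r | r′
    ... | inj₁ refl | inj₁ refl = refl
    ... | inj₂ refl | inj₂ refl = refl
    ... | inj₁ refl | inj₂ refl = contradiction t
          (crossing-apart (proj₂ (edgeᴳ e∈)) (proj₂ (edgeᴴ g∈)) a∈ b∈)
    ... | inj₂ refl | inj₁ refl = contradiction t
          (crossing-apart (proj₂ (edgeᴳ e∈)) (H.symm (proj₂ (edgeᴴ g∈))) a∈ b∈)

K₂ : Graph
K₂ = record
  { V      = Fin 2
  ; order  = 2
  ; index  = ↔-id (Fin 2)
  ; Adj    = _≢_
  ; adj?   = λ u v → ¬? (u ≟ v)
  ; symm   = ≢-sym
  ; irrefl = λ u≡v u≢v → u≢v u≡v
  }

theorem4p1 : ((G H : Graph) → ν-I (G ×ᵍ H) ≥ 2 * ν-I G * ν-I H)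
    × ∃₂ λ (G H : Graph) → ν-I (G ×ᵍ H) ≡ 2 * ν-I G * ν-I H
-- `refl` evaluates both sides to 2, by the exhaustive search in `ν-I`.
theorem4p1 = bound , K₂ , K₂ , refl
  where
  -- The factor 2 is moved to `n`, where it counts the two orientations.
  double : ∀ m n → 2 * m * n ≡ m * (n + n)
  double = solve-∀

  bound : (G H : Graph) → ν-I (G ×ᵍ H) ≥ 2 * ν-I G * ν-I H
  bound G H with ν-I-attained G | ν-I-attained H
  ... | M , m , |M|≡ν | N , n , |N|≡ν = begin
    2 * ν-I G * ν-I H                    ≡⟨ cong₂ (λ i j → 2 * i * j) |M|≡ν |N|≡ν ⟨
    2 * length M * length N              ≡⟨ double (length M) (length N) ⟩
    length M * (length N + length N)     ≡⟨ cong (length M *_) (length-orientations N) ⟨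
    length M * length (orientations N)   ≡⟨ length-cartesianProductWith (over G H) M (orientations N) ⟨
    length (matching× G H m n)           ≤⟨ separated⇒≤ν-I (G ×ᵍ H) (matching×-unique G H m n)
                                              (matching×-edge G H m n) (matching×-separated G H m n) ⟩
    ν-I (G ×ᵍ H)                         ∎
    where open ≤-Reasoning
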